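{- For all integers $k\ge 0$ and $n\ge k+2$, $\mathrm{av}_n^k(1324,1342)$ equals the number of overpartitions of $k$. In particular, $$C_{1324,1342}(x)=\prod_{k\ge 1}\frac{1+x^k}{1-x^k}.$$
   Context: $\mathrm{av}_n^k(B)$ is the number of permutations in $S_n$ with exactly $k$ inversions (pairs $i<j$ with $\pi_i>\pi_j$) that avoid every pattern in $B$; a permutation avoids a pattern $q$ if it has no subsequence order-isomorphic to $q$. If for every $k\ge0$ there are constants $m_k,c_k(B)$ with $\mathrm{av}_n^k(B)=c_k(B)$ for all $n\ge m_k$, then $(c_k(B))_{k\ge0}$ is the limit sequence of $B$ and $C_B(x)=\sum_{k\ge 0}c_k(B)x^k$ is its limit generating function. An overpartition of $k$ is a partition of $k$ in which the first occurrence of each part size may either be overlined or not. -}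

module Defs where

open import Data.Bool using (Bool; true; false; if_then_else_)
import Data.Bool.Properties as Bool
open import Data.Fin as Fin using (Fin; zero; suc; toℕ; punchIn; #_)
import Data.Fin.Properties as Fin
open import Data.Fin.Permutation as Perm
  using (Permutation′; permutation; _⟨$⟩ʳ_; insert; remove; insert-punchIn; insert-remove)
open import Data.Integer as ℤ using (ℤ; +_; 0ℤ; 1ℤ)
import Data.Integer.Properties as ℤ
open import Data.List as List
  using (List; []; _∷_; length; filter; map; allFin; upTo; cartesianProduct; cartesianProductWith)
open import Data.List.Membership.Propositional.Properties
  using (∈-allFin; ∈-upTo⁺; ∈-cartesianProduct⁺)
  renaming (∈-cartesianProductWith⁺ to ∈-cartesianProductWith⁺-≡)
import Data.List.Membership.Setoid as Membership
import Data.List.Membership.Setoid.Properties as ∈ₚ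
import Data.List.Properties as List
open import Data.List.Relation.Unary.All as All using (All; []; _∷_)
open import Data.List.Relation.Unary.All.Properties using (all-filter)
open import Data.List.Relation.Unary.AllPairs as AllPairs using (AllPairs; []; _∷_)
open import Data.List.Relation.Unary.Any using (here; there)
import Data.List.Relation.Unary.Unique.Propositional as Propositional
import Data.List.Relation.Unary.Unique.Propositional.Properties as UniqueP
open import Data.List.Relation.Unary.Unique.Setoid using (Unique)
import Data.List.Relation.Unary.Unique.Setoid.Properties as UniqueS
open import Data.Nat as ℕ using (ℕ; zero; suc; _≤_; _∸_; s≤s; _≡ᵇ_)
open import Data.Nat.ListAction using (sum)
import Data.Nat.Properties as ℕ
open import Data.Product using (Σ-syntax; ∃; ∃-syntax; _×_; _,_; proj₁; proj₂)
open import Data.Vec as Vec using (Vec; []; _∷_; lookup)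
import Data.Vec.Functional as F
open import Level using (_⊔_)
open import Relation.Binary using (Setoid; _Respects_)
open import Relation.Binary.PropositionalEquality
  using (_≡_; _≢_; refl; sym; trans; cong; cong₂; subst₂; setoid; module ≡-Reasoning)
open import Relation.Nullary using (¬_; Dec)
open import Relation.Nullary.Decidable using (True; toWitness; map′; _×-dec_; _→-dec_; ¬?)
open import Relation.Unary using (Pred; Decidable)
open import Algebra.Properties.CommutativeMonoid.Sum ℤ.+-0-commutativeMonoid
  using (sum-cong-≗) renaming (sum to Σℤ)

-- A duplicate-free list of exactly the elements satisfying P, up to _≈_.
-- Its length is thus the number of such elements.
record Enumeration {a ℓ p} (S : Setoid a ℓ) (P : Pred (Setoid.Carrier S) p) : Set (a ⊔ ℓ ⊔ p) where
  open Setoid S using (Carrier)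
  open Membership S using (_∈_)
  field
    elements : List Carrier
    unique   : Unique S elements
    sound    : All P elements
    complete : ∀ {x} → P x → x ∈ elements

  card : ℕ
  card = length elements

open Enumeration using (card)

select : ∀ {a ℓ p} (S : Setoid a ℓ) {P : Pred (Setoid.Carrier S) p} →
         Decidable P → P Respects (Setoid._≈_ S) →
         (xs : List (Setoid.Carrier S)) → Unique S xs →
         (∀ {x} → P x → Membership._∈_ S x xs) → Enumeration S P
select S P? resp xs xs! xs-complete = record
  { elements = filter P? xs
  ; unique   = UniqueS.filter⁺ S P? xs!
  ; sound    = all-filter P? xs
  ; complete = λ Px → ∈ₚ.∈-filter⁺ S P? resp (xs-complete Px) Px
  }

S[_] : ℕ → Setoid _ _
S[ n ] = record
  { Carrier       = Permutation′ n
  ; _≈_           = Perm._≈_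
  ; isEquivalence = record
    { refl  = λ _ → refl
    ; sym   = λ p i → sym (p i)
    ; trans = λ p q i → trans (p i) (q i)
    }
  }

permutations : ∀ n → List (Permutation′ n)
permutations zero    = Perm.id ∷ []
permutations (suc n) = cartesianProductWith (insert zero) (allFin (suc n)) (permutations n)

permutations-unique : ∀ n → Unique S[ n ] (permutations n)
permutations-unique zero    = [] ∷ []
permutations-unique (suc n) =
  UniqueS.cartesianProductWith⁺ (setoid _) S[ n ] S[ suc n ] (insert zero)
    (λ {_} {_} {π} {ρ} → insert-injective {π = π} {ρ})
    (UniqueP.allFin⁺ (suc n)) (permutations-unique n)
  where
  insert-injective : ∀ {i j} {π ρ : Permutation′ n} →
                     insert zero i π Perm.≈ insert zero j ρ → i ≡ j × π Perm.≈ ρ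
  insert-injective {i} {j} {π} {ρ} eq with eq zero
  ... | refl = refl , λ k → Fin.punchIn-injective i _ _ (begin
    punchIn i (π ⟨$⟩ʳ k)            ≡⟨ sym (insert-punchIn zero i π k) ⟩
    insert zero i π ⟨$⟩ʳ suc k      ≡⟨ eq (suc k) ⟩
    insert zero i ρ ⟨$⟩ʳ suc k      ≡⟨ insert-punchIn zero i ρ k ⟩
    punchIn i (ρ ⟨$⟩ʳ k)            ∎)
    where open ≡-Reasoning

permutations-complete : ∀ n (π : Permutation′ n) → Membership._∈_ S[ n ] π (permutations n)
permutations-complete zero    π = here λ ()
permutations-complete (suc n) π =
  ∈ₚ.∈-resp-≈ S[ suc n ]
    {x = insert zero (π ⟨$⟩ʳ zero) (remove zero π)} {y = π} (insert-remove zero π)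
    (∈ₚ.∈-cartesianProductWith⁺ (setoid _) S[ n ] S[ suc n ]
      (λ {_} {_} {π} {ρ} → insert-cong {π = π} {ρ})
      (∈-allFin (π ⟨$⟩ʳ zero)) (permutations-complete n (remove zero π)))
  where
  insert-cong : ∀ {i j} {π ρ : Permutation′ n} → i ≡ j → π Perm.≈ ρ →
                insert zero i π Perm.≈ insert zero j ρ
  insert-cong refl π≈ρ zero    = refl
  insert-cong {i} {π = π} {ρ} refl π≈ρ (suc k) =
    trans (insert-punchIn zero i π k)
      (trans (cong (punchIn i) (π≈ρ k)) (sym (insert-punchIn zero i ρ k)))

IsInversion : ∀ {n} → Permutation′ n → Pred (Fin n × Fin n) _
IsInversion π (i , j) = i Fin.< j × π ⟨$⟩ʳ j Fin.< π ⟨$⟩ʳ i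

isInversion? : ∀ {n} (π : Permutation′ n) → Decidable (IsInversion π)
isInversion? π (i , j) = i Fin.<? j ×-dec π ⟨$⟩ʳ j Fin.<? π ⟨$⟩ʳ i

inversions : ∀ {n} → Permutation′ n → ℕ
inversions {n} π = length (filter (isInversion? π) (cartesianProduct (allFin n) (allFin n)))

Pattern : Set
Pattern = ∃[ m ] Permutation′ m

-- The entries of π at the positions e₀ < e₁ < … form a subsequence
-- order-isomorphic to q.
OccursAt : ∀ {m n} → Permutation′ m → Permutation′ n → Vec (Fin n) m → Set
OccursAt q π e =
  (∀ i j → i Fin.< j → lookup e i Fin.< lookup e j) ×
  (∀ i j → (q ⟨$⟩ʳ i Fin.< q ⟨$⟩ʳ j → π ⟨$⟩ʳ lookup e i Fin.< π ⟨$⟩ʳ lookup e j) ×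
           (π ⟨$⟩ʳ lookup e i Fin.< π ⟨$⟩ʳ lookup e j → q ⟨$⟩ʳ i Fin.< q ⟨$⟩ʳ j))

Contains : ∀ {n} → Permutation′ n → Pattern → Set
Contains {n} π (m , q) = Σ[ e ∈ Vec (Fin n) m ] OccursAt q π e

Avoids : ∀ {n} → List Pattern → Permutation′ n → Set
Avoids B π = All (λ q → ¬ Contains π q) B

anyVec? : ∀ {n m p} {P : Pred (Vec (Fin n) m) p} → Decidable P → Dec (∃ P)
anyVec? {m = zero}  P? = map′ ([] ,_) (λ { ([] , p) → p }) (P? [])
anyVec? {m = suc m} P? =
  map′ (λ { (x , xs , p) → x ∷ xs , p }) (λ { (x ∷ xs , p) → x , xs , p })
    (Fin.any? λ x → anyVec? λ xs → P? (x ∷ xs))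

occursAt? : ∀ {m n} (q : Permutation′ m) (π : Permutation′ n) → Decidable (OccursAt q π)
occursAt? q π e =
  Fin.all? (λ i → Fin.all? λ j → i Fin.<? j →-dec lookup e i Fin.<? lookup e j) ×-dec
  Fin.all? (λ i → Fin.all? λ j →
    (q< i j →-dec π< i j) ×-dec (π< i j →-dec q< i j))
  where
  q< = λ i j → q ⟨$⟩ʳ i Fin.<? q ⟨$⟩ʳ j
  π< = λ i j → π ⟨$⟩ʳ lookup e i Fin.<? π ⟨$⟩ʳ lookup e j

avoids? : ∀ {n} (B : List Pattern) → Decidable (Avoids {n} B)
avoids? B π = All.all? (λ (m , q) → ¬? (anyVec? (occursAt? q π))) B

inversions-cong : ∀ {n} {π ρ : Permutation′ n} → π Perm.≈ ρ → inversions π ≡ inversions ρ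
inversions-cong {n} {π} {ρ} π≈ρ = cong length
  (List.filter-≐ (isInversion? π) (isInversion? ρ)
    ( (λ {(i , j)} (i<j , π>) → i<j , subst₂ Fin._<_ (π≈ρ j) (π≈ρ i) π>)
    , (λ {(i , j)} (i<j , ρ>) → i<j , subst₂ Fin._<_ (sym (π≈ρ j)) (sym (π≈ρ i)) ρ>))
    (cartesianProduct (allFin n) (allFin n)))

avoids-resp : ∀ {n} (B : List Pattern) → Avoids {n} B Respects Perm._≈_
avoids-resp B π≈ρ = All.map λ ¬π (e , inc , iso) → ¬π (e , inc , λ i j →
  let ei = π≈ρ (lookup e i) ; ej = π≈ρ (lookup e j) in
  (λ q< → subst₂ Fin._<_ (sym ei) (sym ej) (proj₁ (iso i j) q<)) ,
  (λ π< → proj₂ (iso i j) (subst₂ Fin._<_ ei ej π<)))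

avoiders : (B : List Pattern) (n k : ℕ) →
           Enumeration S[ n ] (λ π → inversions π ≡ k × Avoids B π)
avoiders B n k = select S[ n ]
  (λ π → inversions π ℕ.≟ k ×-dec avoids? B π)
  (λ {π} {ρ} π≈ρ (inv , av) →
    trans (sym (inversions-cong {π = π} {ρ} π≈ρ)) inv , avoids-resp B {π} {ρ} π≈ρ av)
  (permutations n) (permutations-unique n) (λ {π} _ → permutations-complete n π)

av : List Pattern → ℕ → ℕ → ℕ
av B n k = card (avoiders B n k)

-- The permutation with one-line notation v, given with that of its inverse;
-- positions and values are counted from 0.
oneLine : ∀ {n} (v w : Vec (Fin n) n) →
          {True (Fin.all? λ i → lookup v (lookup w i) Fin.≟ i)} →
          {True (Fin.all? λ i → lookup w (lookup v i) Fin.≟ i)} → Permutation′ n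
oneLine v w {vw} {wv} = permutation (lookup v) (lookup w) (toWitness vw) (toWitness wv)

[1324] : Pattern
[1324] = 4 , oneLine (# 0 ∷ # 2 ∷ # 1 ∷ # 3 ∷ []) (# 0 ∷ # 2 ∷ # 1 ∷ # 3 ∷ [])

[1342] : Pattern
[1342] = 4 , oneLine (# 0 ∷ # 2 ∷ # 3 ∷ # 1 ∷ []) (# 0 ∷ # 3 ∷ # 1 ∷ # 2 ∷ [])

-- A part together with a flag saying whether it is overlined.
Part : Set
Part = ℕ × Bool

-- In `AllPairs R xs`, R relates each entry to every later one; the last
-- component therefore says that an overlined part has no earlier equal part.
IsOverpartition : ℕ → Pred (List Part) _
IsOverpartition k λs =
  All (λ (p , _) → 1 ≤ p) λs ×
  AllPairs (λ (p , _) (q , _) → q ≤ p) λs ×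
  sum (map proj₁ λs) ≡ k ×
  AllPairs (λ (p , _) (q , overlined) → overlined ≡ true → p ≢ q) λs

isOverpartition? : ∀ k → Decidable (IsOverpartition k)
isOverpartition? k λs =
  All.all? (λ (p , _) → 1 ℕ.≤? p) λs ×-dec
  AllPairs.allPairs? (λ (p , _) (q , _) → q ℕ.≤? p) λs ×-dec
  sum (map proj₁ λs) ℕ.≟ k ×-dec
  AllPairs.allPairs? (λ (p , _) (q , o) → o Bool.≟ true →-dec ¬? (p ℕ.≟ q)) λs

listsUpTo : ∀ {a} {A : Set a} → List A → ℕ → List (List A)
listsUpTo xs zero    = [] ∷ []
listsUpTo xs (suc l) = [] ∷ cartesianProductWith _∷_ xs (listsUpTo xs l)

listsUpTo-unique : ∀ {a} {A : Set a} {xs : List A} → Propositional.Unique xs →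
                   ∀ l → Propositional.Unique (listsUpTo xs l)
listsUpTo-unique xs! zero    = [] ∷ []
listsUpTo-unique {xs = xs} xs! (suc l) =
  All.tabulate (λ y∈ []≡y → nonempty y∈ []≡y) ∷
  UniqueP.cartesianProductWith⁺ _∷_ List.∷-injective xs! (listsUpTo-unique xs! l)
  where
  nonempty : ∀ {y} → Membership._∈_ (setoid _) y (cartesianProductWith _∷_ xs (listsUpTo xs l)) → [] ≢ y
  nonempty y∈ refl with ∈ₚ.∈-cartesianProductWith⁻ (setoid _) (setoid _) (setoid _) _∷_ xs (listsUpTo xs l) y∈
  ... | _ , _ , _ , _ , ()

parts : ℕ → List Part
parts k = cartesianProduct (upTo (suc k)) (false ∷ true ∷ [])

listsUpTo-complete : ∀ {k} l (λs : List Part) → All (λ (p , _) → 1 ≤ p) λs →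
                     sum (map proj₁ λs) ≤ l → l ≤ k →
                     Membership._∈_ (setoid _) λs (listsUpTo (parts k) l)
listsUpTo-complete zero    []             _         _   _   = here refl
listsUpTo-complete zero    ((suc _ , _) ∷ _) (_ ∷ _) () _
listsUpTo-complete (suc l) []             _         _   _   = here refl
listsUpTo-complete (suc l) ((suc p , o) ∷ λs) (_ ∷ λs>0) (s≤s le) l<k =
  there (∈-cartesianProductWith⁺-≡ _∷_
    (∈-cartesianProduct⁺
      (∈-upTo⁺ (s≤s (ℕ.≤-trans (s≤s (ℕ.≤-trans (ℕ.m≤m+n p _) le)) l<k)))
      (flag o))
    (listsUpTo-complete l λs λs>0 (ℕ.≤-trans (ℕ.m≤n+m _ p) le) (ℕ.<⇒≤ l<k)))
  where
  flag : ∀ o → Membership._∈_ (setoid _) o (false ∷ true ∷ [])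
  flag false = here refl
  flag true  = there (here refl)

overpartitions : ∀ k → Enumeration (setoid (List Part)) (IsOverpartition k)
overpartitions k = select (setoid _) (isOverpartition? k) (λ { refl P → P })
  (listsUpTo (parts k) k)
  (listsUpTo-unique (UniqueP.cartesianProduct⁺ (UniqueP.upTo⁺ (suc k)) (((λ ()) ∷ []) ∷ [] ∷ [])) k)
  (λ {λs} (λs>0 , _ , sum≡k , _) → listsUpTo-complete k λs λs>0 (ℕ.≤-reflexive sum≡k) ℕ.≤-refl)

#overpartitions : ℕ → ℕ
#overpartitions k = card (overpartitions k)

Series : Set
Series = ℕ → ℤ

infix  4 _≈_
infixl 6 _+_ _-_
infixl 7 _*_ _/_⟨_⟩

_≈_ : Series → Series → Set
f ≈ g = ∀ n → f n ≡ g n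

X^_ : ℕ → Series
(X^ k) n = if n ≡ᵇ k then 1ℤ else 0ℤ

1# : Series
1# = X^ 0

_+_ _-_ _*_ : Series → Series → Series
(f + g) n = f n ℤ.+ g n
(f - g) n = f n ℤ.- g n
(f * g) n = Σℤ {suc n} λ i → f (toℕ i) ℤ.* g (n ∸ toℕ i)

-- The coefficients bₙ, …, b₁, b₀ of 1/f, from b₀ = 1 and
-- bₙ₊₁ = - (f₁ bₙ + f₂ bₙ₋₁ + … + fₙ₊₁ b₀).
recipCoeffs : Series → ∀ n → F.Vector ℤ (suc n)
recipCoeffs f zero    = λ _ → 1ℤ
recipCoeffs f (suc n) = (ℤ.- Σℤ λ i → f (suc (toℕ i)) ℤ.* recipCoeffs f n i) F.∷ recipCoeffs f n

recip : (f : Series) → f 0 ≡ 1ℤ → Series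
recip f _ n = recipCoeffs f n zero

recip-inverse : ∀ f (f₀≡1 : f 0 ≡ 1ℤ) → f * recip f f₀≡1 ≈ 1#
recip-inverse f f₀≡1 zero    = cong (λ z → z ℤ.* 1ℤ ℤ.+ 0ℤ) f₀≡1
recip-inverse f f₀≡1 (suc n) = begin
  f 0 ℤ.* b (suc n) ℤ.+ Σℤ {suc n} (λ i → f (suc (toℕ i)) ℤ.* b (n ∸ toℕ i))
    ≡⟨ cong₂ ℤ._+_ (trans (cong (ℤ._* b (suc n)) f₀≡1) (ℤ.*-identityˡ _))
         (sum-cong-≗ λ i → cong (f (suc (toℕ i)) ℤ.*_) (sym (coeff n i))) ⟩
  b (suc n) ℤ.+ Σℤ (λ i → f (suc (toℕ i)) ℤ.* recipCoeffs f n i)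
    ≡⟨ ℤ.+-inverseˡ (Σℤ λ i → f (suc (toℕ i)) ℤ.* recipCoeffs f n i) ⟩
  0ℤ ∎
  where
  open ≡-Reasoning
  b = recip f f₀≡1
  coeff : ∀ n i → recipCoeffs f n i ≡ b (n ∸ toℕ i)
  coeff zero    zero    = refl
  coeff (suc n) zero    = refl
  coeff (suc n) (suc i) = coeff n i

_/_⟨_⟩ : Series → (g : Series) → g 0 ≡ 1ℤ → Series
f / g ⟨ g₀≡1 ⟩ = f * recip g g₀≡1

-- F 1 * F 2 * … * F m, where F is given on positive indices through k ↦ F (suc k).
partialProduct : (ℕ → Series) → ℕ → Series
partialProduct F zero    = 1#
partialProduct F (suc m) = partialProduct F m * F m

-- P is the infinite product of the F k in the X-adic topology: each
-- coefficient of the partial products is eventually that of P.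
IsInfiniteProduct : (ℕ → Series) → Series → Set
IsInfiniteProduct F P = ∀ n → ∃[ N ] ∀ m → N ≤ m → partialProduct F m n ≡ P n

IsLimitSequence : List Pattern → (ℕ → ℕ) → Set
IsLimitSequence B c = ∀ k → ∃[ m ] ∀ n → m ≤ n → av B n k ≡ c k

generatingFunction : (ℕ → ℕ) → Series
generatingFunction c k = + c k

-- Read a permutation through its Lehmer code, whose entry at a position is the number
-- of smaller values to its right; the entries of the code add up to the number of
-- inversions. When n ≥ k + 2, a code of length n and sum k belongs to an avoider of
-- 1324 and 1342 exactly when it consists of a weakly decreasing sequence of positive
-- entries (a partition), then zeros, and then entries each 0 or as large as possible
-- (a permutation avoiding 213 and 231; the nonzero entries are distinct, so they form
-- a partition into distinct parts). The generating function is thus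
-- ∏ 1/(1 - x^j) · ∏ (1 + x^j). Overpartitions, split by their largest part, give
-- ∏ (1 + x^j)/(1 - x^j), and the factors are rearranged.

module Submission where

open import Defs
open import Data.Bool using (true; false)
open import Data.Empty using (⊥-elim)
open import Data.Fin as Fin using (Fin; zero; suc; toℕ; punchIn; inject₁; inject≤; #_)
import Data.Fin.Properties as Fin
open import Data.Fin.Permutation as Perm
  using (Permutation′; _⟨$⟩ʳ_; _⟨$⟩ˡ_; insert; insert-punchIn; inverseˡ; inverseʳ)
open import Data.Integer as ℤ using (ℤ; +_; 0ℤ; 1ℤ)
import Data.Integer.Properties as ℤ
open import Data.List using (List; []; _∷_; _++_; length; map; allFin; cartesianProduct; cartesianProductWith)
open import Data.List.Membership.Propositional using (_∈_)
open import Data.List.Membership.Propositional.Properties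
  using (∈-allFin; ∈-cartesianProduct⁺; ∈-cartesianProductWith⁺; ∈-++⁺ˡ; ∈-++⁺ʳ; ∈-map⁺)
open import Data.List.Membership.Propositional.Properties.WithK using (unique∧set⇒bag)
import Data.List.Properties as List
open import Data.List.Relation.Binary.BagAndSetEquality using (∼bag⇒↭)
open import Data.List.Relation.Binary.Permutation.Propositional.Properties using (↭-length)
open import Data.List.Relation.Binary.Pointwise as Pointwise using (Pointwise; []; _∷_)
open import Data.List.Relation.Unary.All as All using (All; []; _∷_)
import Data.List.Relation.Unary.All.Properties as All
open import Data.List.Relation.Unary.AllPairs using ([]; _∷_)
open import Data.List.Relation.Unary.Any using (here)
import Data.List.Relation.Unary.Unique.Propositional as Propositional
import Data.List.Relation.Unary.Unique.Propositional.Properties as Unique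
open import Data.Nat as ℕ using (ℕ; zero; suc; pred; _∸_; _≤_; _<_; z≤n; s≤s; s≤s⁻¹)
open import Data.Nat.Induction using (Acc; acc; <-wellFounded)
open import Data.Nat.ListAction using (sum)
import Data.Nat.Properties as ℕ
open import Data.Product using (Σ-syntax; ∃-syntax; _×_; _,_; proj₁; proj₂)
open import Data.Sum as Sum using (_⊎_; inj₁; inj₂; [_,_]′)
open import Data.Unit using (⊤; tt)
open import Data.Vec using (Vec; []; _∷_; lookup)
open import Function using (_∘_; _⇔_; mk⇔; Equivalence)
open import Function.Definitions using (Injective)
open import Level using (0ℓ)
open import Relation.Binary.Definitions using (tri<; tri≈; tri>)
open import Relation.Binary.PropositionalEquality
  using (_≡_; _≢_; refl; sym; trans; cong; cong₂; subst; subst₂; setoid; module ≡-Reasoning)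
open import Relation.Nullary using (¬_; yes; no)
open import Relation.Nullary.Decidable using (_×-dec_; _⊎-dec_)
open import Relation.Unary using (Pred; _⊆_; _∪_; _≐_; Decidable)
open import Algebra.Properties.CommutativeMonoid.Sum ℤ.+-0-commutativeMonoid
  using (sum-cong-≗; ∑-distrib-+; sum-replicate-zero) renaming (sum to Σℤ)

-- Power series

private variable
  A B C : Set
  n : ℕ
  f g h f′ g′ : Series

≈-trans : f ≈ g → g ≈ h → f ≈ h
≈-trans f≈g g≈h n = trans (f≈g n) (g≈h n)

≈-sym : f ≈ g → g ≈ f
≈-sym f≈g n = sym (f≈g n)

+-cong : f ≈ f′ → g ≈ g′ → f + g ≈ f′ + g′
+-cong f≈f′ g≈g′ n = cong₂ ℤ._+_ (f≈f′ n) (g≈g′ n)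

*-cong : f ≈ f′ → g ≈ g′ → f * g ≈ f′ * g′
*-cong f≈f′ g≈g′ n = sum-cong-≗ {suc n} λ i → cong₂ ℤ._*_ (f≈f′ (toℕ i)) (g≈g′ (n ∸ toℕ i))

*-distribʳ-+ : ∀ h f g → (f + g) * h ≈ f * h + g * h
*-distribʳ-+ h f g n =
  trans (sum-cong-≗ {suc n} λ i → ℤ.*-distribʳ-+ (h (n ∸ toℕ i)) (f (toℕ i)) (g (toℕ i)))
        (∑-distrib-+ {suc n} (λ i → f (toℕ i) ℤ.* h (n ∸ toℕ i)) (λ i → g (toℕ i) ℤ.* h (n ∸ toℕ i)))

*-distribˡ-+ : ∀ f g h → f * (g + h) ≈ f * g + f * h
*-distribˡ-+ f g h n =
  trans (sum-cong-≗ {suc n} λ i → ℤ.*-distribˡ-+ (f (toℕ i)) (g (n ∸ toℕ i)) (h (n ∸ toℕ i)))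
        (∑-distrib-+ {suc n} (λ i → f (toℕ i) ℤ.* g (n ∸ toℕ i)) (λ i → f (toℕ i) ℤ.* h (n ∸ toℕ i)))

*-identityˡ : ∀ f → 1# * f ≈ f
*-identityˡ f zero    = trans (ℤ.+-identityʳ _) (ℤ.*-identityˡ (f 0))
*-identityˡ f (suc n) = trans
  (cong₂ ℤ._+_ (ℤ.*-identityˡ (f (suc n)))
    (trans (sum-cong-≗ {suc n} λ i → ℤ.*-zeroˡ (f (n ∸ toℕ i))) (sum-replicate-zero (suc n))))
  (ℤ.+-identityʳ _)

-- Both here and in shift₁-*ʳ the induction uses that, definitionally,
-- (f * g) (suc n) = f 0 · g (suc n) + ((f ∘ suc) * g) n.
*-identityʳ : ∀ f → f * 1# ≈ f
*-identityʳ f zero    = trans (ℤ.+-identityʳ _) (ℤ.*-identityʳ (f 0))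
*-identityʳ f (suc n) = trans
  (cong₂ ℤ._+_ (ℤ.*-zeroʳ (f 0)) (*-identityʳ (λ m → f (suc m)) n))
  (ℤ.+-identityˡ _)

-- Multiplication by `X^ j` (see `X^-*`), in a recursive form that the counting recursions can
-- follow.
shift : ℕ → Series → Series
shift zero    f n       = f n
shift (suc j) f zero    = 0ℤ
shift (suc j) f (suc n) = shift j f n

shift-cong : ∀ j → f ≈ g → shift j f ≈ shift j g
shift-cong zero    f≈g n       = f≈g n
shift-cong (suc j) f≈g zero    = refl
shift-cong (suc j) f≈g (suc n) = shift-cong j f≈g n

shift-< : ∀ j f {n} → n < j → shift j f n ≡ 0ℤ
shift-< (suc j) f {zero}  _   = refl
shift-< (suc j) f {suc n} n<j = shift-< j f (s≤s⁻¹ n<j)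

shift₁-*ʳ : ∀ f g → f * shift 1 g ≈ shift 1 (f * g)
shift₁-*ʳ f g zero          = trans (ℤ.+-identityʳ _) (ℤ.*-zeroʳ (f 0))
shift₁-*ʳ f g (suc zero)    =
  cong (λ z → f 0 ℤ.* g 0 ℤ.+ z) (shift₁-*ʳ (λ m → f (suc m)) g zero)
shift₁-*ʳ f g (suc (suc n)) =
  cong (λ z → f 0 ℤ.* g (suc n) ℤ.+ z) (shift₁-*ʳ (λ m → f (suc m)) g (suc n))

shift₁-*ˡ : ∀ f g → shift 1 f * g ≈ shift 1 (f * g)
shift₁-*ˡ f g zero    = trans (ℤ.+-identityʳ _) (ℤ.*-zeroˡ (g 0))
shift₁-*ˡ f g (suc n) =
  trans (cong (ℤ._+ (f * g) n) (ℤ.*-zeroˡ (g (suc n)))) (ℤ.+-identityˡ _)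

shift-suc : ∀ j f → shift (suc j) f ≈ shift 1 (shift j f)
shift-suc j f zero    = refl
shift-suc j f (suc n) = refl

shift-*ʳ : ∀ j f g → f * shift j g ≈ shift j (f * g)
shift-*ʳ zero    f g n = refl
shift-*ʳ (suc j) f g   =
  ≈-trans (*-cong {f = f} (λ _ → refl) (shift-suc j g))
  (≈-trans (shift₁-*ʳ f (shift j g))
  (≈-trans (shift-cong 1 (shift-*ʳ j f g)) (≈-sym (shift-suc j (f * g)))))

shift-*ˡ : ∀ j f g → shift j f * g ≈ shift j (f * g)
shift-*ˡ zero    f g n = refl
shift-*ˡ (suc j) f g   =
  ≈-trans (*-cong {g = g} (shift-suc j f) (λ _ → refl))
  (≈-trans (shift₁-*ˡ (shift j f) g)
  (≈-trans (shift-cong 1 (shift-*ˡ j f g)) (≈-sym (shift-suc j (f * g)))))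

X^≈shift : ∀ j → X^ j ≈ shift j 1#
X^≈shift zero    n       = refl
X^≈shift (suc j) zero    = refl
X^≈shift (suc j) (suc n) = X^≈shift j n

X^-* : ∀ j f → X^ j * f ≈ shift j f
X^-* j f =
  ≈-trans (*-cong {g = f} (X^≈shift j) (λ _ → refl))
  (≈-trans (shift-*ˡ j 1# f) (shift-cong j (*-identityˡ f)))

minus-plus : ∀ x y → x ℤ.- y ℤ.+ y ≡ x
minus-plus x y =
  trans (ℤ.+-assoc x (ℤ.- y) y) (trans (cong (λ z → x ℤ.+ z) (ℤ.+-inverseˡ y)) (ℤ.+-identityʳ x))

geometric : ℕ → Series
geometric j = recip (1# - X^ (suc j)) refl

-- `X^ (suc j) * r` is added to both sides of (1 - x^(j+1)) r = 1, term by term in the convolution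
-- sum.
geometric-unfold : ∀ j → geometric j ≈ 1# + shift (suc j) (geometric j)
geometric-unfold j n = begin
  r n                                    ≡⟨ *-identityˡ r n ⟨
  (1# * r) n                             ≡⟨ sum-cong-≗ {suc n} split ⟨
  Σℤ {suc n} (λ i → (1# - X^ (suc j)) (toℕ i) ℤ.* r (n ∸ toℕ i) ℤ.+ (X^ (suc j)) (toℕ i) ℤ.* r (n ∸ toℕ i))
    ≡⟨ ∑-distrib-+ {suc n} (λ i → (1# - X^ (suc j)) (toℕ i) ℤ.* r (n ∸ toℕ i))
         (λ i → (X^ (suc j)) (toℕ i) ℤ.* r (n ∸ toℕ i)) ⟩
  ((1# - X^ (suc j)) * r) n ℤ.+ (X^ (suc j) * r) n
    ≡⟨ cong₂ ℤ._+_ (recip-inverse (1# - X^ (suc j)) refl n) (X^-* (suc j) r n) ⟩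
  1# n ℤ.+ shift (suc j) r n             ∎
  where
  open ≡-Reasoning
  r = geometric j
  split : ∀ (i : Fin (suc n)) →
          (1# - X^ (suc j)) (toℕ i) ℤ.* r (n ∸ toℕ i) ℤ.+ (X^ (suc j)) (toℕ i) ℤ.* r (n ∸ toℕ i)
          ≡ 1# (toℕ i) ℤ.* r (n ∸ toℕ i)
  split i = trans (sym (ℤ.*-distribʳ-+ (r (n ∸ toℕ i)) ((1# - X^ (suc j)) (toℕ i)) _))
    (cong (ℤ._* r (n ∸ toℕ i)) (minus-plus (1# (toℕ i)) ((X^ (suc j)) (toℕ i))))

-- The shape of the counting recursions: either no part `suc j` is present, or one is removed and an
-- object of the same kind remains.
*-geometric : ∀ j f → f * geometric j ≈ f + shift (suc j) (f * geometric j)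
*-geometric j f =
  ≈-trans (*-cong {f = f} (λ _ → refl) (geometric-unfold j))
  (≈-trans (*-distribˡ-+ f 1# (shift (suc j) (geometric j)))
  (+-cong (*-identityʳ f) (shift-*ʳ (suc j) f (geometric j))))

overlinedFactor : ℕ → Series
overlinedFactor j = (1# + X^ (suc j)) / (1# - X^ (suc j)) ⟨ refl ⟩

*-overlinedFactor : ∀ j f → f * overlinedFactor j ≈ f * geometric j + shift (suc j) (f * geometric j)
*-overlinedFactor j f =
  ≈-trans (*-cong {f = f} (λ _ → refl)
    (≈-trans (*-distribʳ-+ r 1# (X^ (suc j))) (+-cong (*-identityˡ r) (X^-* (suc j) r))))
  (≈-trans (*-distribˡ-+ f r (shift (suc j) r))
  (+-cong {f = f * r} (λ _ → refl) (shift-*ʳ (suc j) f r)))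
  where r = geometric j

-- Products over part sizes

distinct : ℕ → Series
distinct zero    = 1#
distinct (suc m) = distinct m + shift (suc m) (distinct m)

withParts : ℕ → Series → Series
withParts zero    f = f
withParts (suc b) f = withParts b f * geometric b

-- `withParts b` multiplies by a fixed series, so it commutes with the factor 1 + x^j. Pushing that
-- factor through one geometric series at a time avoids associativity and commutativity of `*`.
withParts-+-shift : ∀ b j f → withParts b (f + shift j f) ≈ withParts b f + shift j (withParts b f)
withParts-+-shift zero    j f n = refl
withParts-+-shift (suc b) j f   =
  ≈-trans (*-cong {g = geometric b} (withParts-+-shift b j f) (λ _ → refl))
  (≈-trans (*-distribʳ-+ (geometric b) u (shift j u))
  (+-cong {f = u * geometric b} (λ _ → refl) (shift-*ˡ j u (geometric b))))
  where u = withParts b f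

-- The factor 1 + x^(m+1) of `distinct (suc m)` moves out past the geometric factors and joins 1/(1
-- - x^(m+1)).
withParts-distinct : ∀ m → withParts m (distinct m) ≈ partialProduct overlinedFactor m
withParts-distinct zero    n = refl
withParts-distinct (suc m)   =
  ≈-trans (*-cong {g = r} (withParts-+-shift m (suc m) (distinct m)) (λ _ → refl))
  (≈-trans (*-distribʳ-+ r u (shift (suc m) u))
  (≈-trans (+-cong {f = u * r} (λ _ → refl) (shift-*ˡ (suc m) u r))
  (≈-trans (≈-sym (*-overlinedFactor m u))
  (*-cong {g = overlinedFactor m} (withParts-distinct m) (λ _ → refl)))))
  where
  r = geometric m
  u = withParts m (distinct m)

-- Each further factor 1 + x^j has j > k and leaves the coefficient of x^k alone.
distinct-stable : ∀ {k} i → distinct (i ℕ.+ k) k ≡ distinct k k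
distinct-stable     zero    = refl
distinct-stable {k} (suc i) = trans
  (cong₂ ℤ._+_ (distinct-stable i) (shift-< (suc (i ℕ.+ k)) _ (s≤s (ℕ.m≤n+m k i))))
  (ℤ.+-identityʳ _)

distinct-stable-≤ : ∀ {k m} → k ≤ m → distinct m k ≡ distinct k k
distinct-stable-≤ {k} {m} k≤m =
  trans (cong (λ m → distinct m k) (sym (ℕ.m∸n+n≡m k≤m))) (distinct-stable (m ∸ k))

-- Counting

card : {P : Pred A 0ℓ} → Enumeration (setoid A) P → ℕ
card = Enumeration.card

infix 4 _HasCard_
_HasCard_ : Pred A 0ℓ → ℤ → Set
P HasCard z = Σ[ E ∈ Enumeration (setoid _) P ] + card E ≡ z

-- Two duplicate-free lists with the same members are permutations of each other, so any convenient
-- enumeration may be built.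
HasCard-unique : ∀ {P : Pred A 0ℓ} {y z} → P HasCard y → P HasCard z → y ≡ z
HasCard-unique (E , refl) (F , refl) = cong +_ (↭-length (∼bag⇒↭ (unique∧set⇒bag
  (unique E) (unique F) (mk⇔ (complete F ∘ All.lookup (sound E)) (complete E ∘ All.lookup (sound F))))))
  where open Enumeration

HasCard-resp : ∀ {P Q : Pred A 0ℓ} {z} → P ≐ Q → P HasCard z → Q HasCard z
HasCard-resp (P⊆Q , Q⊆P) (E , eq) = record
  { elements = elements ; unique = unique ; sound = All.map P⊆Q sound ; complete = complete ∘ Q⊆P } , eq
  where open Enumeration E

HasCard-∅ : ∀ {P : Pred A 0ℓ} → (∀ {x} → ¬ P x) → P HasCard 0ℤ
HasCard-∅ ¬P = record
  { elements = [] ; unique = [] ; sound = [] ; complete = λ Px → ⊥-elim (¬P Px) } , refl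

HasCard-｛_｝ : (x : A) → (x ≡_) HasCard 1ℤ
HasCard-｛ x ｝ = record
  { elements = x ∷ [] ; unique = [] ∷ [] ; sound = refl ∷ [] ; complete = here ∘ sym } , refl

HasCard-∪ : ∀ {P Q : Pred A 0ℓ} {y z} → (∀ {x} → P x → ¬ Q x) →
            P HasCard y → Q HasCard z → P ∪ Q HasCard y ℤ.+ z
HasCard-∪ disjoint (E , refl) (F , refl) = record
  { elements = elements E ++ elements F
  ; unique   = Unique.++⁺ (unique E) (unique F)
      λ (x∈E , x∈F) → disjoint (All.lookup (sound E) x∈E) (All.lookup (sound F) x∈F)
  ; sound    = All.++⁺ (All.map inj₁ (sound E)) (All.map inj₂ (sound F))
  ; complete = [ ∈-++⁺ˡ ∘ complete E , ∈-++⁺ʳ (elements E) ∘ complete F ]′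
  } , cong +_ (List.length-++ (elements E))
  where open Enumeration

Image : (A → B) → Pred A 0ℓ → Pred B 0ℓ
Image f P y = ∃[ x ] f x ≡ y × P x

HasCard-image : ∀ {f : A → B} {P z} → Injective _≡_ _≡_ f → P HasCard z → Image f P HasCard z
HasCard-image {f = f} inj (E , refl) = record
  { elements = map f elements
  ; unique   = Unique.map⁺ inj unique
  ; sound    = All.map⁺ (All.map (λ Px → _ , refl , Px) sound)
  ; complete = λ { (x , refl , Px) → ∈-map⁺ f (complete Px) }
  } , cong +_ (List.length-map f elements)
  where open Enumeration E

Shifted : ℕ → (ℕ → Pred A 0ℓ) → ℕ → Pred A 0ℓ
Shifted j P k x = ∃[ k′ ] j ℕ.+ k′ ≡ k × P k′ x

-- The premise is asked only where `j ℕ.+ k′ ≡ k`; for positive `j` this gives k′ < k, which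
-- well-founded recursion on `k` relies on.
HasCard-shifted : ∀ {P : ℕ → Pred A 0ℓ} {f} j k → (∀ k′ → j ℕ.+ k′ ≡ k → P k′ HasCard f k′) →
                  Shifted j P k HasCard shift j f k
HasCard-shifted zero    k       P# = HasCard-resp ((λ Px → _ , refl , Px) , λ { (_ , refl , Px) → Px }) (P# k refl)
HasCard-shifted (suc j) zero    P# = HasCard-∅ λ { (_ , () , _) }
HasCard-shifted (suc j) (suc k) P# = HasCard-resp
  ( (λ (k′ , eq , Px) → k′ , cong suc eq , Px)
  , (λ (k′ , eq , Px) → k′ , ℕ.suc-injective eq , Px))
  (HasCard-shifted j k λ k′ eq → P# k′ (cong suc eq))

HasCard-cons : ∀ {P : Pred (List A) 0ℓ} {z} x → P HasCard z → Image (x ∷_) P HasCard z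
HasCard-cons x = HasCard-image List.∷-injectiveʳ

-- Overpartitions

BoundedOverpartition : ℕ → ℕ → Pred (List Part) 0ℓ
BoundedOverpartition m k λs = IsOverpartition k λs × All (λ (p , _) → p ≤ m) λs

-- Exactly what `IsOverpartition` demands of the entries after a part `m`.
NotOverlined : ℕ → Pred (List Part) 0ℓ
NotOverlined m = All λ (q , overlined) → overlined ≡ true → m ≢ q

BoundedWithout : ℕ → ℕ → Pred (List Part) 0ℓ
BoundedWithout m k λs = BoundedOverpartition m k λs × NotOverlined m λs

cons-overpartition : ∀ {m k o λs} → Shifted (suc m) (BoundedWithout (suc m)) k λs →
                     BoundedOverpartition (suc m) k ((suc m , o) ∷ λs)
cons-overpartition (_ , refl , ((pos , desc , refl , over) , bounded) , free) =
  (s≤s z≤n ∷ pos , bounded ∷ desc , refl , free ∷ over) , ℕ.≤-refl ∷ bounded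

-- Parts decrease weakly, so if the first is at most `m`, all are.
uncons-overpartition : ∀ {m k p o λs} → BoundedOverpartition (suc m) k ((p , o) ∷ λs) →
                       p ≤ m × BoundedOverpartition m k ((p , o) ∷ λs) ⊎
                       p ≡ suc m × Shifted (suc m) (BoundedWithout (suc m)) k λs
uncons-overpartition ((pos , desc@(q≤p ∷ _) , Σ≡k , over) , p≤1+m ∷ bounded) with ℕ.m≤n⇒m<n∨m≡n p≤1+m
... | inj₁ (s≤s p≤m) = inj₁ (p≤m , (pos , desc , Σ≡k , over) , p≤m ∷ All.map (λ q≤p → ℕ.≤-trans q≤p p≤m) q≤p)
uncons-overpartition ((_ ∷ pos , _ ∷ desc , Σ≡k , free ∷ over) , _ ∷ bounded)
    | inj₂ refl = inj₂ (refl , _ , Σ≡k , ((pos , desc , refl , over) , bounded) , free)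

weaken-bound : ∀ {m k} → BoundedOverpartition m k ⊆ BoundedWithout (suc m) k
weaken-bound (over , bounded) =
  (over , All.map ℕ.m≤n⇒m≤1+n bounded) , All.map (λ q≤m _ → ℕ.<⇒≢ (s≤s q≤m) ∘ sym) bounded

unbounded-cons : ∀ {m k o λs} → ¬ BoundedOverpartition m k ((suc m , o) ∷ λs)
unbounded-cons (_ , 1+m≤m ∷ _) = ℕ.1+n≰n 1+m≤m

-- Removing a leading plain `suc m` leaves a list of the same kind, as in `*-geometric`.
without-split : ∀ m k →
  BoundedOverpartition m k ∪ Image ((suc m , false) ∷_) (Shifted (suc m) (BoundedWithout (suc m)) k)
  ≐ BoundedWithout (suc m) k
without-split m k = to , from
  where
  to : BoundedOverpartition m k ∪ Image ((suc m , false) ∷_) (Shifted (suc m) (BoundedWithout (suc m)) k)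
       ⊆ BoundedWithout (suc m) k
  to (inj₁ b) = weaken-bound b
  to (inj₂ (_ , refl , s@(_ , _ , _ , free))) = cons-overpartition s , (λ ()) ∷ free
  from : BoundedWithout (suc m) k
         ⊆ BoundedOverpartition m k ∪ Image ((suc m , false) ∷_) (Shifted (suc m) (BoundedWithout (suc m)) k)
  from {[]} ((over , []) , _) = inj₁ (over , [])
  from {(p , o) ∷ λs} (b , free) with uncons-overpartition b
  from {(p , o) ∷ λs} (b , free) | inj₁ (_ , b′) = inj₁ b′
  from {(p , false) ∷ λs} (b , free) | inj₂ (refl , s) = inj₂ (λs , refl , s)
  from {(p , true) ∷ λs} (b , ¬≡ ∷ free) | inj₂ (refl , s) = ⊥-elim (¬≡ refl refl)

-- An overlined `suc m` can only come first, and only plain copies of it may follow. This is the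
-- second summand of `*-overlinedFactor`.
bounded-split : ∀ m k →
  BoundedWithout (suc m) k ∪ Image ((suc m , true) ∷_) (Shifted (suc m) (BoundedWithout (suc m)) k)
  ≐ BoundedOverpartition (suc m) k
bounded-split m k = to , from
  where
  to : BoundedWithout (suc m) k ∪ Image ((suc m , true) ∷_) (Shifted (suc m) (BoundedWithout (suc m)) k)
       ⊆ BoundedOverpartition (suc m) k
  to (inj₁ (b , _)) = b
  to (inj₂ (_ , refl , s)) = cons-overpartition s
  from : BoundedOverpartition (suc m) k
         ⊆ BoundedWithout (suc m) k ∪ Image ((suc m , true) ∷_) (Shifted (suc m) (BoundedWithout (suc m)) k)
  from {[]} b = inj₁ (b , [])
  from {(p , o) ∷ λs} b with uncons-overpartition b
  from {(p , o) ∷ λs} b | inj₁ (_ , b′) = inj₁ (weaken-bound b′)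
  from {(p , true) ∷ λs} b | inj₂ (refl , s) = inj₂ (λs , refl , s)
  from {(p , false) ∷ λs} b | inj₂ (refl , s@(_ , _ , _ , free)) = inj₁ (b , (λ ()) ∷ free)

#bounded : ∀ m k → BoundedOverpartition m k HasCard partialProduct overlinedFactor m k
#without : ∀ m k → Acc _<_ k →
           BoundedWithout (suc m) k HasCard (partialProduct overlinedFactor m * geometric m) k

#bounded zero zero = HasCard-resp
  ( (λ { refl → ([] , [] , refl , []) , [] })
  , (λ { {[]} _ → refl ; {(suc _ , _) ∷ _} (_ , () ∷ _) ; {(zero , _) ∷ _} ((() ∷ _ , _) , _) }))
  HasCard-｛ [] ｝
#bounded zero (suc k) = HasCard-∅
  λ { {[]} ((_ , _ , () , _) , _) ; {(suc _ , _) ∷ _} (_ , () ∷ _) ; {(zero , _) ∷ _} ((() ∷ _ , _) , _) }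
#bounded (suc m) k = subst (BoundedOverpartition (suc m) k HasCard_)
  (sym (*-overlinedFactor m (partialProduct overlinedFactor m) k))
  (HasCard-resp (bounded-split m k)
  (HasCard-∪ (λ { (_ , ¬≡ ∷ _) (_ , refl , _) → ¬≡ refl refl })
    (#without m k (<-wellFounded k))
    (HasCard-cons (suc m , true) (HasCard-shifted (suc m) k λ k′ _ → #without m k′ (<-wellFounded k′)))))

#without m k (acc rs) = subst (BoundedWithout (suc m) k HasCard_)
  (sym (*-geometric m (partialProduct overlinedFactor m) k))
  (HasCard-resp (without-split m k)
  (HasCard-∪ (λ { b (_ , refl , _) → unbounded-cons b })
    (#bounded m k)
    (HasCard-cons (suc m , false) (HasCard-shifted (suc m) k
      λ { k′ refl → #without m k′ (rs (s≤s (ℕ.m≤n+m k′ m))) }))))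

parts≤sum : ∀ (λs : List Part) → All (λ (p , _) → p ≤ sum (map proj₁ λs)) λs
parts≤sum []             = []
parts≤sum ((p , _) ∷ λs) = ℕ.m≤m+n p _ ∷ All.map (λ q≤ → ℕ.≤-trans q≤ (ℕ.m≤n+m _ p)) (parts≤sum λs)

-- No part exceeds the sum `k`, so the bound `m` excludes nothing. Allowing every `m` from `k` on
-- also yields the stability that `IsInfiniteProduct` asks for.
#overpartitions-product : ∀ {m k} → k ≤ m → + #overpartitions k ≡ partialProduct overlinedFactor m k
#overpartitions-product {m} {k} k≤m = HasCard-unique (overpartitions k , refl) (HasCard-resp
  ( proj₁
  , (λ { {λs} over@(_ , _ , refl , _) → over , All.map (λ p≤ → ℕ.≤-trans p≤ k≤m) (parts≤sum λs) }))
  (#bounded m k))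

-- Lehmer codes

-- The values ≥ v among the entries after a first entry i, once those entries
-- are renumbered consecutively from 0, become the values ≥ lower v i.
lower : ℕ → ℕ → ℕ
lower v i with i ℕ.<? v
... | yes _ = pred v
... | no  _ = v

lower-mono : ∀ {v w} i → v ≤ w → lower v i ≤ lower w i
lower-mono {v} {w} i v≤w with i ℕ.<? v | i ℕ.<? w
... | yes _   | yes _   = ℕ.pred-mono-≤ v≤w
... | yes i<v | no  i≮w = ⊥-elim (i≮w (ℕ.<-≤-trans i<v v≤w))
... | no  i≮v | yes (s≤s i≤w) = ℕ.≤-trans (ℕ.≮⇒≥ i≮v) i≤w
... | no  _   | no  _   = v≤w

lower-≤ : ∀ v i → lower v i ≤ v
lower-≤ v i with i ℕ.<? v
... | yes _ = ℕ.pred[n]≤n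
... | no  _ = ℕ.≤-refl

≤-lower : ∀ {v i} → i ≤ v → i ≤ lower v i
≤-lower {v} {i} i≤v with i ℕ.<? v
... | yes (s≤s i≤v′) = i≤v′
... | no  _          = i≤v

-- The values ≥ v avoid 213 and 231: none of them lies strictly between two later ones.
-- An entry i is below v or the least of them when i ≤ v, and exceeds all later values
-- when i ≡ length c.
Extremal : ℕ → List ℕ → Set
Extremal v []      = ⊤
Extremal v (i ∷ c) = (i ≤ v ⊎ i ≡ length c) × Extremal (lower v i) c

-- Codes of permutations avoiding 1324 and 1342: for each i, the later values above it
-- avoid 213 and 231.
Good : List ℕ → Set
Good []      = ⊤
Good (i ∷ c) = i ≤ length c × Extremal i c × Good c

extremal? : ∀ v → Decidable (Extremal v)
extremal? v []      = yes tt
extremal? v (i ∷ c) = (i ℕ.≤? v ⊎-dec i ℕ.≟ length c) ×-dec extremal? (lower v i) c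

good? : Decidable Good
good? []      = yes tt
good? (i ∷ c) = i ℕ.≤? length c ×-dec extremal? i c ×-dec good? c

Extremal-mono : ∀ {v w} → v ≤ w → Extremal v ⊆ Extremal w
Extremal-mono v≤w {[]}    _         = tt
Extremal-mono v≤w {i ∷ c} (i≤ , ex) =
  Sum.map₁ (λ i≤v → ℕ.≤-trans i≤v v≤w) i≤ , Extremal-mono (lower-mono i v≤w) ex

Extremal₀⇒Good : Extremal 0 ⊆ Good
Extremal₀⇒Good {[]}    _         = tt
Extremal₀⇒Good {i ∷ c} (i≤ , ex) =
  [ (λ i≤0 → ℕ.≤-trans i≤0 z≤n) , ℕ.≤-reflexive ]′ i≤ , Extremal-mono z≤n ex , Extremal₀⇒Good ex

-- Counting codes

ExtremalCode : ℕ → ℕ → Pred (List ℕ) 0ℓ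
ExtremalCode n k c = length c ≡ n × sum c ≡ k × Extremal 0 c

-- At threshold 0 an entry is 0 or maximal, and `lower 0 i` is 0 again. The two choices differ only
-- if another entry follows, hence the length `suc (suc n)`.
extremal-split : ∀ n k →
  Image (0 ∷_) (ExtremalCode (suc n) k) ∪ Image (suc n ∷_) (Shifted (suc n) (ExtremalCode (suc n)) k)
  ≐ ExtremalCode (suc (suc n)) k
extremal-split n k = to , from
  where
  to : Image (0 ∷_) (ExtremalCode (suc n) k) ∪ Image (suc n ∷_) (Shifted (suc n) (ExtremalCode (suc n)) k)
       ⊆ ExtremalCode (suc (suc n)) k
  to (inj₁ (_ , refl , len , sum≡ , ex)) = cong suc len , sum≡ , inj₁ z≤n , ex
  to (inj₂ (_ , refl , _ , refl , len , refl , ex)) = cong suc len , refl , inj₂ (sym len) , ex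
  from : ExtremalCode (suc (suc n)) k
         ⊆ Image (0 ∷_) (ExtremalCode (suc n) k) ∪ Image (suc n ∷_) (Shifted (suc n) (ExtremalCode (suc n)) k)
  from {0 ∷ c} (len , sum≡ , _ , ex) = inj₁ (c , refl , ℕ.suc-injective len , sum≡ , ex)
  from {suc i ∷ c} (len , refl , inj₂ i≡ , ex) with trans i≡ (ℕ.suc-injective len)
  ... | refl = inj₂ (c , refl , _ , refl , ℕ.suc-injective len , refl , ex)

#extremal : ∀ n k → ExtremalCode (suc n) k HasCard distinct n k
#extremal zero zero = HasCard-resp
  ( (λ { refl → refl , refl , inj₁ z≤n , tt })
  , (λ { {0 ∷ []} _ → refl }))
  HasCard-｛ 0 ∷ [] ｝
#extremal zero (suc k) = HasCard-∅
  λ { {0 ∷ []} (_ , () , _) ; {suc _ ∷ []} (_ , _ , inj₁ () , _) ; {suc _ ∷ []} (_ , _ , inj₂ () , _) }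
#extremal (suc n) k = HasCard-resp (extremal-split n k)
  (HasCard-∪ (λ { (_ , refl , _) (_ , () , _) })
    (HasCard-cons 0 (#extremal n k))
    (HasCard-cons (suc n) (HasCard-shifted (suc n) k λ k′ _ → #extremal n k′)))

HeadAtMost : ℕ → Pred (List ℕ) 0ℓ
HeadAtMost b []      = ⊤
HeadAtMost b (i ∷ _) = i ≤ b

-- For sums small against the length, the initial positive entries decrease weakly, so bounding the
-- head bounds them all. The bound matches that of `withParts b`.
GoodCode : ℕ → ℕ → ℕ → Pred (List ℕ) 0ℓ
GoodCode b n k c = length c ≡ n × sum c ≡ k × Good c × HeadAtMost b c

-- After a first entry 0 all later values lie above it, so the whole tail must avoid 213 and 231.
good-zero : ∀ n k → Image (0 ∷_) (ExtremalCode n k) ≐ GoodCode 0 (suc n) k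
good-zero n k =
  (λ { (_ , refl , len , sum≡ , ex) → cong suc len , sum≡ , (z≤n , ex , Extremal₀⇒Good ex) , z≤n }) ,
  (λ { {0 ∷ c} (len , sum≡ , (_ , ex , _) , _) → c , refl , ℕ.suc-injective len , sum≡ , ex })

good-split : ∀ b n k → 2 ℕ.+ k ≤ suc n →
  GoodCode b (suc n) k ∪ Image (suc b ∷_) (Shifted (suc b) (GoodCode (suc b) n) k)
  ≐ GoodCode (suc b) (suc n) k
good-split b n k (s≤s k<n) = to , from
  where
  -- The head p is at most `suc b`, so `lower (suc b) p` is still at least p, and the condition that
  -- `Good` gives at threshold p suffices.
  extend : ∀ {c} → Good c → HeadAtMost (suc b) c → Extremal (suc b) c
  extend {[]}    _            _   = tt
  extend {p ∷ c} (_ , ex , _) p≤b = inj₁ p≤b , Extremal-mono (≤-lower p≤b) ex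
  to : GoodCode b (suc n) k ∪ Image (suc b ∷_) (Shifted (suc b) (GoodCode (suc b) n) k)
       ⊆ GoodCode (suc b) (suc n) k
  to {_ ∷ _} (inj₁ (len , sum≡ , good , i≤b)) = len , sum≡ , good , ℕ.m≤n⇒m≤1+n i≤b
  to (inj₂ (c , refl , _ , refl , refl , refl , good , head≤)) =
    refl , refl , (ℕ.≤-trans (s≤s (ℕ.m≤m+n b (sum c))) (ℕ.<⇒≤ k<n) , extend good head≤ , good) , ℕ.≤-refl
  -- The alternative p = length c would make the code sum too large for its length.
  head≤ : ∀ {c} → suc b ℕ.+ sum c < length c → Extremal (suc b) c → HeadAtMost (suc b) c
  head≤ {[]}    _    _               = tt
  head≤ {p ∷ c} _    (inj₁ p≤  , _) = p≤
  head≤ {p ∷ c} sum< (inj₂ refl , _) = ⊥-elim (ℕ.<⇒≱ (s≤s⁻¹ sum<)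
    (ℕ.≤-trans (ℕ.m≤m+n p (sum c)) (ℕ.m≤n+m (p ℕ.+ sum c) b)))
  from : GoodCode (suc b) (suc n) k
         ⊆ GoodCode b (suc n) k ∪ Image (suc b ∷_) (Shifted (suc b) (GoodCode (suc b) n) k)
  from {i ∷ c} (len , sum≡ , good , i≤1+b) with ℕ.m≤n⇒m<n∨m≡n i≤1+b
  ... | inj₁ (s≤s i≤b) = inj₁ (len , sum≡ , good , i≤b)
  from {i ∷ c} (refl , refl , (_ , ex , good) , _) | inj₂ refl =
    inj₂ (c , refl , _ , refl , refl , refl , good , head≤ k<n ex)

-- `M` stays fixed while `k` falls, so that a single series serves the whole recursion. By stability
-- every `M` from `k` on gives the same coefficient.
#good : ∀ b {M k n} → Acc _<_ k → k ≤ M → 2 ℕ.+ k ≤ n → GoodCode b n k HasCard withParts b (distinct M) k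
#good zero {M} {k} {suc (suc n)} _ k≤M (s≤s (s≤s k≤n)) =
  subst (GoodCode 0 (2 ℕ.+ n) k HasCard_) (trans (distinct-stable-≤ k≤n) (sym (distinct-stable-≤ k≤M)))
    (HasCard-resp (good-zero (suc n) k) (HasCard-cons 0 (#extremal n k)))
#good (suc b) {M} {k} {suc n} (acc rs) k≤M k+2≤n =
  subst (GoodCode (suc b) (suc n) k HasCard_) (sym (*-geometric b (withParts b (distinct M)) k))
    (HasCard-resp (good-split b n k k+2≤n)
      (HasCard-∪ (λ { (_ , _ , _ , 1+b≤b) (_ , refl , _) → ℕ.1+n≰n 1+b≤b })
        (#good b (acc rs) k≤M k+2≤n)
        (HasCard-cons (suc b) (HasCard-shifted (suc b) k λ k′ eq →
          let k′<k = subst (k′ <_) eq (s≤s (ℕ.m≤n+m k′ b)) in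
          #good (suc b) (rs k′<k) (ℕ.≤-trans (ℕ.<⇒≤ k′<k) k≤M)
            -- The code loses one entry and its sum drops by at least one, so the bound 2 + k ≤ n
            -- persists.
            (s≤s⁻¹ (ℕ.≤-trans (s≤s (s≤s k′<k)) k+2≤n))))))

codes : ℕ → List (List ℕ)
codes zero    = [] ∷ []
codes (suc n) = cartesianProductWith (λ i c → toℕ i ∷ c) (allFin (suc n)) (codes n)

codes-unique : ∀ n → Propositional.Unique (codes n)
codes-unique zero    = [] ∷ []
codes-unique (suc n) = Unique.cartesianProductWith⁺ (λ i c → toℕ i ∷ c)
  (λ eq → Fin.toℕ-injective (List.∷-injectiveˡ eq) , List.∷-injectiveʳ eq)
  (Unique.allFin⁺ (suc n)) (codes-unique n)

codes-complete : ∀ {c} → Good c → c ∈ codes (length c)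
codes-complete {[]}    _               = here refl
codes-complete {i ∷ c} (i≤ , _ , good) = subst (λ j → j ∷ c ∈ codes (suc (length c)))
  (Fin.toℕ-fromℕ< (s≤s i≤))
  (∈-cartesianProductWith⁺ (λ i c → toℕ i ∷ c) (∈-allFin (Fin.fromℕ< (s≤s i≤))) (codes-complete good))

-- Order and `punchIn`

toℕ-punchIn-< : ∀ (i : Fin (suc n)) w → toℕ w < toℕ i → toℕ (punchIn i w) ≡ toℕ w
toℕ-punchIn-< (suc i) zero    _         = refl
toℕ-punchIn-< (suc i) (suc w) (s≤s w<i) = cong suc (toℕ-punchIn-< i w w<i)

toℕ-punchIn-≥ : ∀ (i : Fin (suc n)) w → toℕ i ≤ toℕ w → toℕ (punchIn i w) ≡ suc (toℕ w)
toℕ-punchIn-≥ zero    w       _         = refl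
toℕ-punchIn-≥ (suc i) (suc w) (s≤s i≤w) = cong suc (toℕ-punchIn-≥ i w i≤w)

punchIn-mono-< : ∀ (i : Fin (suc n)) {v w} → v Fin.< w → punchIn i v Fin.< punchIn i w
punchIn-mono-< i v<w = ℕ.≰⇒> λ w≤v → ℕ.<⇒≱ v<w (Fin.punchIn-cancel-≤ i _ _ w≤v)

punchIn-cancel-< : ∀ (i : Fin (suc n)) {v w} → punchIn i v Fin.< punchIn i w → v Fin.< w
punchIn-cancel-< i v<w = ℕ.≰⇒> λ w≤v → ℕ.<⇒≱ v<w (Fin.punchIn-mono-≤ i _ _ w≤v)

punchIn<⁺ : ∀ (i : Fin (suc n)) {w} → toℕ w < toℕ i → punchIn i w Fin.< i
punchIn<⁺ i w<i = subst (_< toℕ i) (sym (toℕ-punchIn-< i _ w<i)) w<i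

punchIn<⁻ : ∀ (i : Fin (suc n)) {w} → punchIn i w Fin.< i → toℕ w < toℕ i
punchIn<⁻ i {w} pw<i = ℕ.≰⇒> λ i≤w →
  ℕ.<⇒≱ pw<i (ℕ.≤-trans (ℕ.m≤n⇒m≤1+n i≤w) (ℕ.≤-reflexive (sym (toℕ-punchIn-≥ i w i≤w))))

<punchIn⁺ : ∀ (i : Fin (suc n)) {w} → toℕ i ≤ toℕ w → i Fin.< punchIn i w
<punchIn⁺ i i≤w = ℕ.≤-trans (s≤s i≤w) (ℕ.≤-reflexive (sym (toℕ-punchIn-≥ i _ i≤w)))

<punchIn⁻ : ∀ (i : Fin (suc n)) {w} → i Fin.< punchIn i w → toℕ i ≤ toℕ w
<punchIn⁻ i i<pw = ℕ.≮⇒≥ λ w<i → ℕ.<-asym i<pw (punchIn<⁺ i w<i)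

-- With the converse below: `lower` at a fixed entry i is left adjoint to `punchIn i`, so it carries
-- thresholds to the renumbered values.
≤punchIn⁺ : ∀ (i : Fin (suc n)) {v w} → lower v (toℕ i) ≤ toℕ w → v ≤ toℕ (punchIn i w)
≤punchIn⁺ i {v} {w} l≤w with toℕ i ℕ.<? v
... | yes (s≤s i≤v) = ℕ.≤-trans (s≤s l≤w) (ℕ.≤-reflexive (sym (toℕ-punchIn-≥ i w (ℕ.≤-trans i≤v l≤w))))
... | no  _ with toℕ w ℕ.<? toℕ i
...   | yes w<i = ℕ.≤-trans l≤w (ℕ.≤-reflexive (sym (toℕ-punchIn-< i w w<i)))
...   | no  w≮i = ℕ.≤-trans (ℕ.m≤n⇒m≤1+n l≤w) (ℕ.≤-reflexive (sym (toℕ-punchIn-≥ i w (ℕ.≮⇒≥ w≮i))))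

≤punchIn⁻ : ∀ (i : Fin (suc n)) {v w} → v ≤ toℕ (punchIn i w) → lower v (toℕ i) ≤ toℕ w
≤punchIn⁻ i {v} {w} v≤pw with toℕ i ℕ.<? v | toℕ w ℕ.<? toℕ i
... | yes _   | no  w≮i = ℕ.pred-mono-≤ (ℕ.≤-trans v≤pw (ℕ.≤-reflexive (toℕ-punchIn-≥ i w (ℕ.≮⇒≥ w≮i))))
... | no  _   | yes w<i = ℕ.≤-trans v≤pw (ℕ.≤-reflexive (toℕ-punchIn-< i w w<i))
... | no  i≮v | no  w≮i = ℕ.≤-trans (ℕ.≮⇒≥ i≮v) (ℕ.≮⇒≥ w≮i)
... | yes i<v | yes w<i = ⊥-elim (ℕ.<-asym i<v
  (ℕ.≤-<-trans (ℕ.≤-trans v≤pw (ℕ.≤-reflexive (toℕ-punchIn-< i w w<i))) w<i))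

-- Inserting a first entry into a permutation

inversionsEnumeration : (π : Permutation′ n) → Enumeration (setoid (Fin n × Fin n)) (IsInversion π)
inversionsEnumeration {n} π = select (setoid _) (isInversion? π) (λ { refl inv → inv })
  (cartesianProduct (allFin n) (allFin n))
  (Unique.cartesianProduct⁺ (Unique.allFin⁺ n) (Unique.allFin⁺ n))
  (λ _ → ∈-cartesianProduct⁺ (∈-allFin _) (∈-allFin _))

#Fin : ∀ m → (λ (_ : Fin m) → ⊤) HasCard (+ m)
#Fin m = record
  { elements = allFin m
  ; unique   = Unique.allFin⁺ m
  ; sound    = All.universal (λ _ → tt) (allFin m)
  ; complete = λ _ → ∈-allFin _
  } , cong +_ (List.length-tabulate {n = m} (λ i → i))

#smallerValues : ∀ {m} → m ≤ n → (π : Permutation′ n) → (λ j → toℕ (π ⟨$⟩ʳ j) < m) HasCard (+ m)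
#smallerValues {n} {m} m≤n π = HasCard-resp
  ( (λ { (w , refl , _) → subst (_< m) (sym (value w)) (Fin.toℕ<n w) })
  , (λ {j} πj<m → Fin.fromℕ< πj<m , trans
      (cong (π ⟨$⟩ˡ_) (Fin.toℕ-injective (trans (Fin.toℕ-inject≤ _ m≤n) (Fin.toℕ-fromℕ< πj<m))))
      (inverseˡ π) , tt))
  (HasCard-image injective (#Fin m))
  where
  position : Fin m → Fin n
  position w = π ⟨$⟩ˡ inject≤ w m≤n
  value : ∀ w → toℕ (π ⟨$⟩ʳ position w) ≡ toℕ w
  value w = trans (cong toℕ (inverseʳ π)) (Fin.toℕ-inject≤ w m≤n)
  injective : ∀ {v w} → position v ≡ position w → v ≡ w
  injective {v} {w} eq = Fin.toℕ-injective
    (trans (sym (value v)) (trans (cong (λ p → toℕ (π ⟨$⟩ʳ p)) eq) (value w)))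

-- An occurrence of 213 (x < y) or 231 (y < x) among the values from `v` on. The value at x is the
-- least of the three, so it alone is compared with `v`.
HasInnerEntry : ℕ → Permutation′ n → Set
HasInnerEntry v π = ∃[ b ] ∃[ x ] ∃[ y ] b Fin.< x × b Fin.< y ×
  v ≤ toℕ (π ⟨$⟩ʳ x) × π ⟨$⟩ʳ x Fin.< π ⟨$⟩ʳ b × π ⟨$⟩ʳ b Fin.< π ⟨$⟩ʳ y

-- x < y gives an occurrence of 1324 and y < x one of 1342.
ContainsPattern : Permutation′ n → Set
ContainsPattern π = ∃[ a ] ∃[ b ] ∃[ x ] ∃[ y ] a Fin.< b × b Fin.< x × b Fin.< y ×
  π ⟨$⟩ʳ a Fin.< π ⟨$⟩ʳ x × π ⟨$⟩ʳ x Fin.< π ⟨$⟩ʳ b × π ⟨$⟩ʳ b Fin.< π ⟨$⟩ʳ y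

module _ (i : Fin (suc n)) (π : Permutation′ n) where
  private
    ρ = insert zero i π

    ρ-suc : ∀ k → ρ ⟨$⟩ʳ suc k ≡ punchIn i (π ⟨$⟩ʳ k)
    ρ-suc = insert-punchIn zero i π

  suc<suc⁺ : ∀ {j k} → π ⟨$⟩ʳ j Fin.< π ⟨$⟩ʳ k → ρ ⟨$⟩ʳ suc j Fin.< ρ ⟨$⟩ʳ suc k
  suc<suc⁺ = subst₂ Fin._<_ (sym (ρ-suc _)) (sym (ρ-suc _)) ∘ punchIn-mono-< i

  suc<suc⁻ : ∀ {j k} → ρ ⟨$⟩ʳ suc j Fin.< ρ ⟨$⟩ʳ suc k → π ⟨$⟩ʳ j Fin.< π ⟨$⟩ʳ k
  suc<suc⁻ = punchIn-cancel-< i ∘ subst₂ Fin._<_ (ρ-suc _) (ρ-suc _)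

  suc<zero⁺ : ∀ {k} → π ⟨$⟩ʳ k Fin.< i → ρ ⟨$⟩ʳ suc k Fin.< i
  suc<zero⁺ = subst (Fin._< i) (sym (ρ-suc _)) ∘ punchIn<⁺ i

  suc<zero⁻ : ∀ {k} → ρ ⟨$⟩ʳ suc k Fin.< i → π ⟨$⟩ʳ k Fin.< i
  suc<zero⁻ = punchIn<⁻ i ∘ subst (Fin._< i) (ρ-suc _)

  zero<suc⁺ : ∀ {k} → i Fin.≤ π ⟨$⟩ʳ k → i Fin.< ρ ⟨$⟩ʳ suc k
  zero<suc⁺ = subst (i Fin.<_) (sym (ρ-suc _)) ∘ <punchIn⁺ i

  zero<suc⁻ : ∀ {k} → i Fin.< ρ ⟨$⟩ʳ suc k → i Fin.≤ π ⟨$⟩ʳ k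
  zero<suc⁻ = <punchIn⁻ i ∘ subst (i Fin.<_) (ρ-suc _)

  ≤suc⁺ : ∀ {v k} → lower v (toℕ i) ≤ toℕ (π ⟨$⟩ʳ k) → v ≤ toℕ (ρ ⟨$⟩ʳ suc k)
  ≤suc⁺ {v} = subst (λ w → v ≤ toℕ w) (sym (ρ-suc _)) ∘ ≤punchIn⁺ i

  ≤suc⁻ : ∀ {v k} → v ≤ toℕ (ρ ⟨$⟩ʳ suc k) → lower v (toℕ i) ≤ toℕ (π ⟨$⟩ʳ k)
  ≤suc⁻ {v} = ≤punchIn⁻ i ∘ subst (λ w → v ≤ toℕ w) (ρ-suc _)

  -- The first position is inverted with exactly the `toℕ i` later positions that hold smaller
  -- values; all other inversions come from `π`.
  inversions-insert : inversions ρ ≡ toℕ i ℕ.+ inversions π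
  inversions-insert = ℤ.+-injective (HasCard-unique
    (inversionsEnumeration ρ , refl)
    (HasCard-resp (to , from)
      (HasCard-∪ (λ { (_ , refl , _) (_ , () , _) })
        (HasCard-image (λ { refl → refl }) (#smallerValues (s≤s⁻¹ (Fin.toℕ<n i)) π))
        (HasCard-image (λ { refl → refl }) (inversionsEnumeration π , refl)))))
    where
    atZero : Fin n → Fin (suc n) × Fin (suc n)
    atZero j = zero , suc j
    later : Fin n × Fin n → Fin (suc n) × Fin (suc n)
    later (j , k) = suc j , suc k
    to : Image atZero (λ j → toℕ (π ⟨$⟩ʳ j) < toℕ i) ∪ Image later (IsInversion π) ⊆ IsInversion ρ
    to (inj₁ (_ , refl , πj<i)) = s≤s z≤n , suc<zero⁺ πj<i
    to (inj₂ (_ , refl , j<k , π>)) = s≤s j<k , suc<suc⁺ π>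
    from : IsInversion ρ ⊆ Image atZero (λ j → toℕ (π ⟨$⟩ʳ j) < toℕ i) ∪ Image later (IsInversion π)
    from {zero  , suc k} (_       , ρ>) = inj₁ (k , refl , suc<zero⁻ ρ>)
    from {suc j , suc k} (s≤s j<k , ρ>) = inj₂ ((j , k) , refl , j<k , suc<suc⁻ ρ>)

  inner-insert⁺ : ∀ {v} → HasInnerEntry (lower v (toℕ i)) π ⊎ v < toℕ i × toℕ i < n → HasInnerEntry v ρ
  inner-insert⁺ (inj₁ (b , x , y , b<x , b<y , v≤x , x<b , b<y′)) =
    suc b , suc x , suc y , s≤s b<x , s≤s b<y , ≤suc⁺ v≤x , suc<suc⁺ x<b , suc<suc⁺ b<y′
  -- The new entry plays b. The old value `v`, below `i` and so unchanged, plays x; the old value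
  -- `i`, raised by one, plays y.
  inner-insert⁺ {v} (inj₂ (v<i , i<n)) =
    zero , suc (position v<n) , suc (position i<n) , s≤s z≤n , s≤s z≤n ,
    ≤suc⁺ (ℕ.≤-trans (lower-≤ v (toℕ i)) (ℕ.≤-reflexive (sym (value v<n)))) ,
    suc<zero⁺ (subst (_< toℕ i) (sym (value v<n)) v<i) ,
    zero<suc⁺ (ℕ.≤-reflexive (sym (value i<n)))
    where
    v<n = ℕ.<-trans v<i i<n
    position : ∀ {w} → w < n → Fin n
    position w<n = π ⟨$⟩ˡ Fin.fromℕ< w<n
    value : ∀ {w} (w<n : w < n) → toℕ (π ⟨$⟩ʳ position w<n) ≡ w
    value w<n = trans (cong toℕ (inverseʳ π)) (Fin.toℕ-fromℕ< w<n)

  inner-insert⁻ : ∀ {v} → HasInnerEntry v ρ → HasInnerEntry (lower v (toℕ i)) π ⊎ v < toℕ i × toℕ i < n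
  inner-insert⁻ (zero , suc x , suc y , _ , _ , v≤x , x<b , b<y) =
    inj₂ (ℕ.≤-<-trans v≤x x<b , ℕ.≤-<-trans (zero<suc⁻ b<y) (Fin.toℕ<n (π ⟨$⟩ʳ y)))
  inner-insert⁻ (suc b , suc x , suc y , s≤s b<x , s≤s b<y , v≤x , x<b , b<y′) =
    inj₁ (b , x , y , b<x , b<y , ≤suc⁻ v≤x , suc<suc⁻ x<b , suc<suc⁻ b<y′)

  contains-insert⁺ : ContainsPattern π ⊎ HasInnerEntry (toℕ i) π → ContainsPattern ρ
  contains-insert⁺ (inj₁ (a , b , x , y , a<b , b<x , b<y , a<x , x<b , b<y′)) =
    suc a , suc b , suc x , suc y , s≤s a<b , s≤s b<x , s≤s b<y , suc<suc⁺ a<x , suc<suc⁺ x<b , suc<suc⁺ b<y′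
  contains-insert⁺ (inj₂ (b , x , y , b<x , b<y , i≤x , x<b , b<y′)) =
    zero , suc b , suc x , suc y , s≤s z≤n , s≤s b<x , s≤s b<y , zero<suc⁺ i≤x , suc<suc⁺ x<b , suc<suc⁺ b<y′

  -- The new entry comes first, so it can only be the 1 of an occurrence; the other three entries
  -- then have values above it.
  contains-insert⁻ : ContainsPattern ρ → ContainsPattern π ⊎ HasInnerEntry (toℕ i) π
  contains-insert⁻ (zero , suc b , suc x , suc y , _ , s≤s b<x , s≤s b<y , a<x , x<b , b<y′) =
    inj₂ (b , x , y , b<x , b<y , zero<suc⁻ a<x , suc<suc⁻ x<b , suc<suc⁻ b<y′)
  contains-insert⁻ (suc a , suc b , suc x , suc y , s≤s a<b , s≤s b<x , s≤s b<y , a<x , x<b , b<y′) =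
    inj₁ (a , b , x , y , a<b , b<x , b<y , suc<suc⁻ a<x , suc<suc⁻ x<b , suc<suc⁻ b<y′)

-- Codes of permutations

record IsCodeOf (π : Permutation′ n) (c : List ℕ) : Set where
  field
    length≡     : length c ≡ n
    inversions≡ : inversions π ≡ sum c
    -- All thresholds are covered because a new first entry i replaces `v` by `lower v i`.
    extremal⇔   : ∀ v → (¬ HasInnerEntry v π) ⇔ Extremal v c
    good⇔       : (¬ ContainsPattern π) ⇔ Good c

-- All values smaller than the first entry come after it, so the new Lehmer entry is that value
-- itself. A new inner entry arises exactly when v < i < n; since the order is decidable, its
-- negation is the disjunction in `Extremal`.
insert-code : ∀ (i : Fin (suc n)) {π c} → IsCodeOf π c → IsCodeOf (insert zero i π) (toℕ i ∷ c)
insert-code {n} i {π} {c} isCode = record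
  { length≡     = cong suc length≡
  ; inversions≡ = trans (inversions-insert i π) (cong (toℕ i ℕ.+_) inversions≡)
  ; extremal⇔   = λ v → mk⇔
      (λ ¬inner → allowed (¬inner ∘ inner-insert⁺ i π ∘ inj₂) ,
                  to (extremal⇔ _) (¬inner ∘ inner-insert⁺ i π ∘ inj₁))
      (λ (i≤ , ex) → [ from (extremal⇔ _) ex , forbidden i≤ ]′ ∘ inner-insert⁻ i π)
  ; good⇔       = mk⇔
      (λ ¬contains → subst (toℕ i ≤_) (sym length≡) (s≤s⁻¹ (Fin.toℕ<n i)) ,
                to (extremal⇔ _) (¬contains ∘ contains-insert⁺ i π ∘ inj₂) ,
                to good⇔ (¬contains ∘ contains-insert⁺ i π ∘ inj₁))
      (λ (_ , ex , good) → [ from good⇔ good , from (extremal⇔ _) ex ]′ ∘ contains-insert⁻ i π)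
  }
  where
  open IsCodeOf isCode
  open Equivalence
  allowed : ∀ {v} → ¬ (v < toℕ i × toℕ i < n) → toℕ i ≤ v ⊎ toℕ i ≡ length c
  allowed {v} ¬both with toℕ i ℕ.≤? v
  ... | yes i≤v = inj₁ i≤v
  ... | no  i≰v = inj₂ (trans
    (ℕ.≤-antisym (s≤s⁻¹ (Fin.toℕ<n i)) (ℕ.≮⇒≥ λ i<n → ¬both (ℕ.≰⇒> i≰v , i<n))) (sym length≡))
  forbidden : ∀ {v} → toℕ i ≤ v ⊎ toℕ i ≡ length c → ¬ (v < toℕ i × toℕ i < n)
  forbidden (inj₁ i≤v) (v<i , _) = ℕ.<⇒≱ v<i i≤v
  forbidden (inj₂ i≡n) (_ , i<n) = ℕ.<⇒≢ i<n (trans i≡n length≡)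

id-code : IsCodeOf {0} Perm.id []
id-code = record
  { length≡     = refl
  ; inversions≡ = refl
  ; extremal⇔   = λ _ → mk⇔ (λ _ → tt) (λ { _ (() , _) })
  ; good⇔       = mk⇔ (λ _ → tt) (λ { _ (() , _) })
  }

cartesianProductWith-Pointwise :
  ∀ {A₁ A₂ B₁ B₂ : Set} {R : A₁ → A₂ → Set} {S : B₁ → B₂ → Set} {f : C → A₁ → B₁} {g : C → A₂ → B₂} →
  (∀ z {x y} → R x y → S (f z x) (g z y)) → ∀ zs {xs ys} → Pointwise R xs ys →
  Pointwise S (cartesianProductWith f zs xs) (cartesianProductWith g zs ys)
cartesianProductWith-Pointwise fRg []       rs = []
cartesianProductWith-Pointwise {f = f} {g} fRg (z ∷ zs) rs =
  Pointwise.++⁺ (Pointwise.map⁺ (f z) (g z) (Pointwise.map (fRg z) rs)) (cartesianProductWith-Pointwise fRg zs rs)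

permutations-codes : ∀ n → Pointwise IsCodeOf (permutations n) (codes n)
permutations-codes zero    = id-code ∷ []
permutations-codes (suc n) =
  cartesianProductWith-Pointwise insert-code (allFin (suc n)) (permutations-codes n)

-- Pattern avoidance

patterns : List Pattern
patterns = [1324] ∷ [1342] ∷ []

increasing : ∀ {m} (f : Fin (suc m) → ℕ) → (∀ i → f (inject₁ i) < f (suc i)) → ∀ i j → i Fin.< j → f i < f j
increasing {suc m} f step zero    (suc zero)    _ = step zero
increasing {suc m} f step zero    (suc (suc j)) _ =
  ℕ.<-trans (step zero) (increasing (f ∘ suc) (step ∘ suc) zero (suc j) (s≤s z≤n))
increasing {suc m} f step (suc i) (suc j)       (s≤s i<j) = increasing (f ∘ suc) (step ∘ suc) i j i<j

-- `q ⟨$⟩ˡ v` is the position of the value v in `q`, so it is enough to compare neighbouring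
-- positions and neighbouring values. Trichotomy then gives the reverse implication.
occursAt : ∀ {m} (q : Permutation′ (suc m)) (π : Permutation′ n) (e : Vec (Fin n) (suc m)) →
           (∀ i → lookup e (inject₁ i) Fin.< lookup e (suc i)) →
           (∀ i → π ⟨$⟩ʳ lookup e (q ⟨$⟩ˡ inject₁ i) Fin.< π ⟨$⟩ʳ lookup e (q ⟨$⟩ˡ suc i)) →
           OccursAt q π e
occursAt q π e e-step π-step =
  increasing (toℕ ∘ lookup e) e-step , λ i j → π-mono i j , π-reflects i j
  where
  π-mono : ∀ i j → q ⟨$⟩ʳ i Fin.< q ⟨$⟩ʳ j → π ⟨$⟩ʳ lookup e i Fin.< π ⟨$⟩ʳ lookup e j
  π-mono i j q< = subst₂ (λ i j → π ⟨$⟩ʳ lookup e i Fin.< π ⟨$⟩ʳ lookup e j) (inverseˡ q) (inverseˡ q)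
    (increasing (λ v → toℕ (π ⟨$⟩ʳ lookup e (q ⟨$⟩ˡ v))) π-step (q ⟨$⟩ʳ i) (q ⟨$⟩ʳ j) q<)
  π-reflects : ∀ i j → π ⟨$⟩ʳ lookup e i Fin.< π ⟨$⟩ʳ lookup e j → q ⟨$⟩ʳ i Fin.< q ⟨$⟩ʳ j
  π-reflects i j π< with Fin.<-cmp (q ⟨$⟩ʳ i) (q ⟨$⟩ʳ j)
  ... | tri< q< _ _ = q<
  ... | tri> _ _ q> = ⊥-elim (ℕ.<-asym π< (π-mono j i q>))
  ... | tri≈ _ q≡ _ = ⊥-elim (ℕ.<-irrefl (cong (λ k → toℕ (π ⟨$⟩ʳ lookup e k))
    (trans (sym (inverseˡ q)) (trans (cong (q ⟨$⟩ˡ_) q≡) (inverseˡ q)))) π<)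

avoids⇒¬contains : ∀ (π : Permutation′ n) → Avoids patterns π → ¬ ContainsPattern π
avoids⇒¬contains π (¬1324 ∷ ¬1342 ∷ []) (a , b , x , y , a<b , b<x , b<y , πa<πx , πx<πb , πb<πy)
  with Fin.<-cmp x y
... | tri< x<y _ _ = ¬1324 (e , occursAt (proj₂ [1324]) π e
  (λ { zero → a<b ; (suc zero) → b<x ; (suc (suc zero)) → x<y })
  (λ { zero → πa<πx ; (suc zero) → πx<πb ; (suc (suc zero)) → πb<πy }))
  where e = a ∷ b ∷ x ∷ y ∷ []
... | tri> _ _ y<x = ¬1342 (e , occursAt (proj₂ [1342]) π e
  (λ { zero → a<b ; (suc zero) → b<y ; (suc (suc zero)) → y<x })
  (λ { zero → πa<πx ; (suc zero) → πx<πb ; (suc (suc zero)) → πb<πy }))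
  where e = a ∷ b ∷ y ∷ x ∷ []
... | tri≈ _ refl _ = ⊥-elim (ℕ.<-asym πx<πb πb<πy)

¬contains⇒avoids : ∀ (π : Permutation′ n) → ¬ ContainsPattern π → Avoids patterns π
¬contains⇒avoids π ¬contains =
  (λ { ((a ∷ b ∷ x ∷ y ∷ []) , inc , iso) → ¬contains (a , b , x , y ,
    inc (# 0) (# 1) (s≤s z≤n) , inc (# 1) (# 2) (s≤s (s≤s z≤n)) , inc (# 1) (# 3) (s≤s (s≤s z≤n)) ,
    proj₁ (iso (# 0) (# 2)) (s≤s z≤n) , proj₁ (iso (# 2) (# 1)) (s≤s (s≤s z≤n)) ,
    proj₁ (iso (# 1) (# 3)) (s≤s (s≤s (s≤s z≤n)))) }) ∷
  (λ { ((a ∷ b ∷ y ∷ x ∷ []) , inc , iso) → ¬contains (a , b , x , y ,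
    inc (# 0) (# 1) (s≤s z≤n) , inc (# 1) (# 3) (s≤s (s≤s z≤n)) , inc (# 1) (# 2) (s≤s (s≤s z≤n)) ,
    proj₁ (iso (# 0) (# 3)) (s≤s z≤n) , proj₁ (iso (# 3) (# 1)) (s≤s (s≤s z≤n)) ,
    proj₁ (iso (# 1) (# 2)) (s≤s (s≤s (s≤s z≤n)))) }) ∷ []

goodCodes : ∀ n k → Enumeration (setoid (List ℕ)) (λ c → length c ≡ n × sum c ≡ k × Good c)
goodCodes n k = select (setoid _) (λ c → length c ℕ.≟ n ×-dec sum c ℕ.≟ k ×-dec good? c)
  (λ { refl p → p }) (codes n) (codes-unique n) (λ { (refl , _ , good) → codes-complete good })

-- `permutations` and `codes` run through their choices in the same order, and the two filters agree
-- on corresponding entries, so they keep equally many.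
av≡#goodCodes : ∀ n k → av patterns n k ≡ card (goodCodes n k)
av≡#goodCodes n k = Pointwise.Pointwise-length (Pointwise.filter⁺
  (λ π → inversions π ℕ.≟ k ×-dec avoids? patterns π)
  (λ c → length c ℕ.≟ n ×-dec sum c ℕ.≟ k ×-dec good? c)
  (λ {π} isCode (inv , avoids) → let open IsCodeOf isCode in
    length≡ , trans (sym inversions≡) inv , to good⇔ (avoids⇒¬contains π avoids))
  (λ {π} isCode (_ , sum≡ , good) → let open IsCodeOf isCode in
    trans inversions≡ sum≡ , ¬contains⇒avoids π (from good⇔ good))
  (permutations-codes n))
  where open Equivalence

head≤sum : ∀ c → HeadAtMost (sum c) c
head≤sum []      = tt
head≤sum (i ∷ c) = ℕ.m≤m+n i (sum c)

av-product : ∀ {n k} → 2 ℕ.+ k ≤ n → + av patterns n k ≡ partialProduct overlinedFactor k k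
av-product {n} {k} 2+k≤n = begin
  + av patterns n k              ≡⟨ cong +_ (av≡#goodCodes n k) ⟩
  + card (goodCodes n k)   ≡⟨ HasCard-unique (goodCodes n k , refl) (HasCard-resp
    ( (λ (len , sum≡ , good , _) → len , sum≡ , good)
    , (λ { {c} (len , refl , good) → len , refl , good , head≤sum c }))
    -- The head never exceeds the sum, so `k` serves as the head bound as well as for `M`.
    (#good k (<-wellFounded k) ℕ.≤-refl 2+k≤n)) ⟩
  withParts k (distinct k) k ≡⟨ withParts-distinct k k ⟩
  partialProduct overlinedFactor k k ∎
  where open ≡-Reasoning

proposition5p7 : (∀ k n → k ℕ.+ 2 ≤ n → av ([1324] ∷ [1342] ∷ []) n k ≡ #overpartitions k)
    × (Σ[ c ∈ (ℕ → ℕ) ]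
    (IsLimitSequence ([1324] ∷ [1342] ∷ []) c
    × IsInfiniteProduct
    (λ j → (1# + X^ (suc j)) / (1# - X^ (suc j)) ⟨ refl ⟩)
    (generatingFunction c)))
proposition5p7 =
  av≡ , #overpartitions ,
  (λ k → k ℕ.+ 2 , λ n → av≡ k n) ,
  (λ k → k , λ m k≤m → sym (#overpartitions-product k≤m))
  where
  av≡ : ∀ k n → k ℕ.+ 2 ≤ n → av patterns n k ≡ #overpartitions k
  av≡ k n k+2≤n = ℤ.+-injective (trans
    (av-product (subst (_≤ n) (ℕ.+-comm k 2) k+2≤n))
    (sym (#overpartitions-product {k} {k} ℕ.≤-refl)))
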